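{- Let $P$ be a rooted forest on $[n]$ with natural labeling. For $1\le i\le n$ let $G_i$ be the $\mathcal{L}(P)\times\mathcal{L}(P)$ $0$-$1$ matrix with $G_i(\pi',\pi)=1$ if and only if $\pi'=\pi\partial_{\pi^{ -1}_i}$. Then the monoid $\mathcal{M}$ generated by $G_1,\dots,G_n$ under matrix multiplication is $\mathcal{R}$-trivial.
   Context: A rooted forest is a disjoint union of rooted trees, a rooted tree being a connected finite poset in which each element is covered by at most one element. $\mathcal{L}(P)=\{\pi\in S_n : i\prec j \Rightarrow \pi^{ -1}_i<\pi^{ -1}_j\}$ in one-line notation. $\pi\tau_i$ ($1\le i<n$) swaps $\pi_i,\pi_{i+1}$ if they are incomparable in $P$ and is $\pi$ otherwise; operators act on the right; $\partial_j=\tau_j\tau_{j+1}\cdots\tau_{n-1}$. (Equivalently $G_i$ is $\overline{M}=M+(x_1+\cdots+x_n)\mathbb{1}$ evaluated at $x_i=1$, $x_j=0$ for $j\ne i$, where $M$ is the promotion graph transition matrix.) A finite monoid $\mathcal{M}$ (with identity) is $\mathcal{R}$-trivial if $x\mathcal{M}=y\mathcal{M}$ implies $x=y$ for all $x,y\in\mathcal{M}$. -}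

module Defs where

open import Algebra.Bundles using (Monoid)
import Algebra.Properties.Semiring.Sum as SemiringSum
open import Data.Bool.Base using (if_then_else_)
open import Data.Fin.Base as Fin using (Fin; zero; suc; inject₁; toℕ)
import Data.Fin.Properties as Fin
open import Data.Fin.Permutation
  using (Permutation′; _⟨$⟩ʳ_; _⟨$⟩ˡ_; _∘ₚ_; transpose; insert; remove;
         insert-punchIn; insert-remove; inverseˡ; inverseʳ)
  renaming (_≈_ to _≈ₚ_; id to idₚ)
open import Data.List.Base
  using (List; []; _∷_; allFin; cartesianProductWith; filter; foldl; length; lookup)
import Data.List.Membership.Setoid as SetoidMembership
import Data.List.Membership.Setoid.Properties as Membership
open import Data.List.Membership.Propositional.Properties using (∈-allFin)
open import Data.List.Relation.Unary.Any using (here)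
import Data.List.Relation.Unary.All as All
import Data.List.Relation.Unary.AllPairs as AllPairs
import Data.List.Relation.Unary.Enumerates.Setoid as Enumerates
import Data.List.Relation.Unary.Unique.Setoid as SetoidUnique
import Data.List.Relation.Unary.Unique.Setoid.Properties as Unique
import Data.List.Relation.Unary.Unique.Propositional.Properties as UniqueP
open import Data.Nat.Base using (ℕ; zero; suc; _+_; _*_)
import Data.Nat.Properties as ℕ
open import Data.Product.Base using (∃; ∃-syntax; _×_; _,_; proj₁; proj₂)
open import Data.Sum.Base using (_⊎_)
open import Function.Base using (_∘_)
open import Function.Bundles using (_⇔_; mk⇔)
open import Level using (Level; 0ℓ; _⊔_) renaming (suc to lsuc)
open import Relation.Binary.Bundles using (Setoid; Poset)
open import Relation.Binary.Core using (Rel)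
open import Relation.Binary.Structures using (IsDecPartialOrder)
open import Relation.Binary.Construct.Closure.Equivalence using (EqClosure)
import Relation.Binary.Construct.NonStrictToStrict as ToStrict
import Relation.Binary.Construct.On as On
open import Relation.Binary.PropositionalEquality
  using (_≡_; refl; sym; trans; cong; cong₂; setoid; module ≡-Reasoning)
open import Relation.Nullary using (¬_; Dec; does; yes; no)
open import Relation.Nullary.Decidable using (_→-dec_; _⊎-dec_)
open import Relation.Unary using (Pred; _≐_)

private
  variable
    a b c ℓ ℓ₁ ℓ₂ : Level
    n N : ℕ

-- Finiteness up to the setoid equality: some list meets every class.
Finite : Setoid a ℓ → Set (a ⊔ ℓ)
Finite S = ∃ IsEnumeration
  where open Enumerates S

module _ (P : Poset a ℓ₁ ℓ₂) where
  open Poset P using (module Eq) renaming (Carrier to A; _≈_ to _≈ᴾ_; _≤_ to _⪯_)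
  open ToStrict _≈ᴾ_ _⪯_ renaming (_<_ to _≺_)

  _IsCoveredBy_ : A → A → Set (a ⊔ ℓ₁ ⊔ ℓ₂)
  x IsCoveredBy y = x ≺ y × ¬ (∃[ z ] (x ≺ z × z ≺ y))

  -- `connected` says that the comparability graph (equivalently, the Hasse
  -- diagram) is connected; the empty poset is not excluded, which is
  -- immaterial for disjoint unions.
  record IsRootedTree : Set (a ⊔ ℓ₁ ⊔ ℓ₂) where
    field
      finite          : Finite Eq.setoid
      connected       : ∀ x y → EqClosure _⪯_ x y
      atMostOneCover  : ∀ x y z → x IsCoveredBy y → x IsCoveredBy z → y ≈ᴾ z

module _ (P : Poset a ℓ₁ ℓ₂) where
  open Poset P using () renaming (Carrier to A; _≤_ to _⪯_)

  -- The subposet of P on the elements with colour i.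
  fibre : ∀ {k} → (A → Fin k) → Fin k → Poset a ℓ₁ ℓ₂
  fibre colour i = On.poset P (proj₁ {B = λ x → colour x ≡ i})

  -- P is a disjoint union of k rooted trees: `colour` splits P into k
  -- subposets with no relations between distinct ones.
  record IsRootedForest : Set (a ⊔ ℓ₁ ⊔ ℓ₂) where
    field
      k         : ℕ
      colour    : A → Fin k
      disjoint  : ∀ x y → x ⪯ y → colour x ≡ colour y
      trees     : ∀ i → IsRootedTree (fibre colour i)

-- Here and below [n] is Fin n, whose elements are numbered from 0.
record PosetOn (n : ℕ) ℓ : Set (lsuc ℓ) where
  infix 4 _⪯_ _≺_
  field
    _⪯_                : Rel (Fin n) ℓ
    isDecPartialOrder  : IsDecPartialOrder _≡_ _⪯_

  open IsDecPartialOrder isDecPartialOrder public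
    using (isPartialOrder) renaming (_≤?_ to _⪯?_; _≟_ to _≟ᴾ_)

  poset : Poset 0ℓ 0ℓ ℓ
  poset = record { isPartialOrder = isPartialOrder }

  _≺_ : Rel (Fin n) ℓ
  _≺_ = ToStrict._<_ _≡_ _⪯_

  _≺?_ : ∀ i j → Dec (i ≺ j)
  _≺?_ = ToStrict.<-decidable _≡_ _⪯_ _≟ᴾ_ _⪯?_

  Comparable : Rel (Fin n) ℓ
  Comparable i j = i ⪯ j ⊎ j ⪯ i

  comparable? : ∀ i j → Dec (Comparable i j)
  comparable? i j = (i ⪯? j) ⊎-dec (j ⪯? i)

  IsNaturallyLabelled : Set ℓ
  IsNaturallyLabelled = ∀ i j → i ≺ j → i Fin.< j

-- One-line notation: the entry π_i is π ⟨$⟩ʳ i, and π⁻¹_i is π ⟨$⟩ˡ i.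
-- Permutations are compared entrywise.
permutationSetoid : ℕ → Setoid 0ℓ 0ℓ
permutationSetoid n = record
  { Carrier        = Permutation′ n
  ; _≈_            = _≈ₚ_
  ; isEquivalence  = record
    { refl   = λ _ → refl
    ; sym    = λ p i → sym (p i)
    ; trans  = λ p q i → trans (p i) (q i)
    }
  }

_≈ₚ?_ : (π σ : Permutation′ n) → Dec (π ≈ₚ σ)
π ≈ₚ? σ = Fin.all? λ i → (π ⟨$⟩ʳ i) Fin.≟ (σ ⟨$⟩ʳ i)

permutations : ∀ n → List (Permutation′ n)
permutations zero     = idₚ ∷ []
permutations (suc n)  =
  cartesianProductWith (insert zero) (allFin (suc n)) (permutations n)

module _ {n ℓ} (P : PosetOn n ℓ) where
  open PosetOn P using (_≺_; _≺?_)

  IsLinearExtension : Permutation′ n → Set ℓ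
  IsLinearExtension π = ∀ i j → i ≺ j → (π ⟨$⟩ˡ i) Fin.< (π ⟨$⟩ˡ j)

  isLinearExtension? : ∀ π → Dec (IsLinearExtension π)
  isLinearExtension? π = Fin.all? λ i → Fin.all? λ j →
    (i ≺? j) →-dec ((π ⟨$⟩ˡ i) Fin.<? (π ⟨$⟩ˡ j))

  -- 𝓛(P), listed without repetition (see `∈-linearExtensions` and
  -- `linearExtensions-unique`).
  linearExtensions : List (Permutation′ n)
  linearExtensions = filter isLinearExtension? (permutations n)

-- π τ_i, exchanging the entries of π in positions i and i+1. `_∘ₚ_` composes
-- in diagrammatic order.
τ : PosetOn (suc n) ℓ → Permutation′ (suc n) → Fin n → Permutation′ (suc n)
τ P π i =
  if does (comparable? (π ⟨$⟩ʳ inject₁ i) (π ⟨$⟩ʳ suc i))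
  then π
  else transpose (inject₁ i) (suc i) ∘ₚ π
  where open PosetOn P using (comparable?)

-- π ∂_j = (⋯((π τ_j) τ_{j+1}) ⋯) τ_{n-1}
∂ : PosetOn n ℓ → Permutation′ n → Fin n → Permutation′ n
∂ {n = suc m} P π j = foldl (τ P) π (filter (λ i → toℕ j ℕ.≤? toℕ i) (allFin m))

-- Square matrices over ℕ under the usual product.
open SemiringSum ℕ.+-*-semiring
  using (sum; ∑-comm; sum-cong-≗; *-distribˡ-sum; *-distribʳ-sum)

Matrix : ℕ → Set
Matrix N = Fin N → Fin N → ℕ

infix 4 _≋_
infixl 7 _⊗_

_≋_ : Rel (Matrix N) 0ℓ
A ≋ B = ∀ r s → A r s ≡ B r s

_⊗_ : Matrix N → Matrix N → Matrix N
(A ⊗ B) r s = sum (λ t → A r t * B t s)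

𝟙 : Matrix N
𝟙 r s = if does (r Fin.≟ s) then 1 else 0

private
  open ≡-Reasoning

  ⊗-assoc : (A B C : Matrix N) → A ⊗ B ⊗ C ≋ A ⊗ (B ⊗ C)
  ⊗-assoc A B C r s = begin
    sum (λ t → sum (λ u → A r u * B u t) * C t s)
      ≡⟨ sum-cong-≗ (λ t → *-distribʳ-sum (C t s) (λ u → A r u * B u t)) ⟩
    sum (λ t → sum (λ u → A r u * B u t * C t s))
      ≡⟨ ∑-comm (λ t u → A r u * B u t * C t s) ⟩
    sum (λ u → sum (λ t → A r u * B u t * C t s))
      ≡⟨ sum-cong-≗ (λ u → sum-cong-≗ (λ t → ℕ.*-assoc (A r u) (B u t) (C t s))) ⟩
    sum (λ u → sum (λ t → A r u * (B u t * C t s)))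
      ≡⟨ sum-cong-≗ (λ u → *-distribˡ-sum (A r u) (λ t → B u t * C t s)) ⟨
    sum (λ u → A r u * sum (λ t → B u t * C t s)) ∎

  sum-zero : ∀ N → sum {N} (λ _ → 0) ≡ 0
  sum-zero zero     = refl
  sum-zero (suc N)  = sum-zero N

  𝟙-suc : (r s : Fin N) → 𝟙 (suc r) (suc s) ≡ 𝟙 r s
  𝟙-suc r s with r Fin.≟ s
  ... | yes _ = refl
  ... | no  _ = refl

  sum-𝟙ˡ : (r : Fin N) (f : Fin N → ℕ) → sum (λ t → 𝟙 r t * f t) ≡ f r
  sum-𝟙ˡ {suc N} zero f = begin
    f zero + 0 + sum {N} (λ _ → 0)  ≡⟨ cong (f zero + 0 +_) (sum-zero N) ⟩
    f zero + 0 + 0                  ≡⟨ ℕ.+-identityʳ (f zero + 0) ⟩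
    f zero + 0                      ≡⟨ ℕ.+-identityʳ (f zero) ⟩
    f zero                          ∎
  sum-𝟙ˡ (suc r) f = trans
    (sum-cong-≗ (λ t → cong (_* f (suc t)) (𝟙-suc r t))) (sum-𝟙ˡ r (f ∘ suc))

  𝟙-sym : (r s : Fin N) → 𝟙 r s ≡ 𝟙 s r
  𝟙-sym zero    zero    = refl
  𝟙-sym zero    (suc s) = refl
  𝟙-sym (suc r) zero    = refl
  𝟙-sym (suc r) (suc s) = trans (𝟙-suc r s) (trans (𝟙-sym r s) (sym (𝟙-suc s r)))

  ⊗-identityˡ : (A : Matrix N) → 𝟙 ⊗ A ≋ A
  ⊗-identityˡ A r s = sum-𝟙ˡ r (λ t → A t s)

  ⊗-identityʳ : (A : Matrix N) → A ⊗ 𝟙 ≋ A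
  ⊗-identityʳ A r s = trans
    (sum-cong-≗ (λ t → trans (ℕ.*-comm (A r t) (𝟙 t s)) (cong (_* A r t) (𝟙-sym t s))))
    (sum-𝟙ˡ s (A r))

matrixMonoid : ℕ → Monoid 0ℓ 0ℓ
matrixMonoid N = record
  { Carrier   = Matrix N
  ; _≈_       = _≋_
  ; _∙_       = _⊗_
  ; ε         = 𝟙
  ; isMonoid  = record
    { isSemigroup = record
      { isMagma = record
        { isEquivalence = record
          { refl   = λ _ _ → refl
          ; sym    = λ p r s → sym (p r s)
          ; trans  = λ p q r s → trans (p r s) (q r s)
          }
        ; ∙-cong = λ p q r s → sum-cong-≗ (λ t → cong₂ _*_ (p r t) (q t s))
        }
      ; assoc = ⊗-assoc
      }
    ; identity = ⊗-identityˡ , ⊗-identityʳ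
    }
  }

module _ (M : Monoid c ℓ) {I : Set b} (gen : I → Monoid.Carrier M) where
  open Monoid M

  data Generated : Carrier → Set (b ⊔ c) where
    generator  : ∀ i → Generated (gen i)
    unit       : Generated ε
    product    : ∀ {x y} → Generated x → Generated y → Generated (x ∙ y)

  generatedSubmonoid : Monoid (b ⊔ c) ℓ
  generatedSubmonoid = record
    { Carrier   = ∃ Generated
    ; _≈_       = λ x y → proj₁ x ≈ proj₁ y
    ; _∙_       = λ x y → proj₁ x ∙ proj₁ y , product (proj₂ x) (proj₂ y)
    ; ε         = ε , unit
    ; isMonoid  = record
      { isSemigroup = record
        { isMagma = record
          { isEquivalence  = On.isEquivalence proj₁ isEquivalence
          ; ∙-cong         = ∙-cong
          }
        ; assoc = λ x y z → assoc (proj₁ x) (proj₁ y) (proj₁ z)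
        }
      ; identity = (λ x → identityˡ (proj₁ x)) , (λ x → identityʳ (proj₁ x))
      }
    }

module _ (M : Monoid c ℓ) where
  open Monoid M

  -- The principal right ideal x M.
  rightIdeal : Carrier → Pred Carrier (c ⊔ ℓ)
  rightIdeal x z = ∃[ m ] z ≈ x ∙ m

  record IsRTrivial : Set (c ⊔ ℓ) where
    field
      finite    : Finite (Monoid.setoid M)
      rTrivial  : ∀ x y → rightIdeal x ≐ rightIdeal y → x ≈ y

module _ {n ℓ} (P : PosetOn n ℓ) where

  -- Rows and columns are indexed by the positions in `linearExtensions P`:
  -- row π′, column π.
  G : Fin n → Matrix (length (linearExtensions P))
  G i r s = if does (π′ ≈ₚ? ∂ P π (π ⟨$⟩ˡ i)) then 1 else 0
    where
    π′ = lookup (linearExtensions P) r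
    π  = lookup (linearExtensions P) s

  promotionMonoid : Monoid 0ℓ 0ℓ
  promotionMonoid = generatedSubmonoid (matrixMonoid _) G

module _ {n : ℕ} where
  open SetoidMembership (permutationSetoid n) public using () renaming (_∈_ to _∈ₚ_)
  open SetoidUnique (permutationSetoid n) public using () renaming (Unique to Uniqueₚ)

private
  insert-cong : ∀ {j k : Fin (suc n)} {π σ : Permutation′ n} → j ≡ k → π ≈ₚ σ →
                insert zero j π ≈ₚ insert zero k σ
  insert-cong refl p zero = refl
  insert-cong {j = j} {π = π} {σ} refl p (suc i) = begin
    insert zero j π ⟨$⟩ʳ suc i  ≡⟨ insert-punchIn zero j π i ⟩
    Fin.punchIn j (π ⟨$⟩ʳ i)    ≡⟨ cong (Fin.punchIn j) (p i) ⟩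
    Fin.punchIn j (σ ⟨$⟩ʳ i)    ≡⟨ insert-punchIn zero j σ i ⟨
    insert zero j σ ⟨$⟩ʳ suc i  ∎

  insert-injective : ∀ {j k : Fin (suc n)} {π σ : Permutation′ n} →
                     insert zero j π ≈ₚ insert zero k σ → j ≡ k × π ≈ₚ σ
  insert-injective {j = j} {k} {π} {σ} p with p zero
  ... | refl = refl , λ i → Fin.punchIn-injective j (π ⟨$⟩ʳ i) (σ ⟨$⟩ʳ i) (begin
    Fin.punchIn j (π ⟨$⟩ʳ i)    ≡⟨ insert-punchIn zero j π i ⟨
    insert zero j π ⟨$⟩ʳ suc i  ≡⟨ p (suc i) ⟩
    insert zero j σ ⟨$⟩ʳ suc i  ≡⟨ insert-punchIn zero j σ i ⟩
    Fin.punchIn j (σ ⟨$⟩ʳ i)    ∎)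

∈-permutations : ∀ n (π : Permutation′ n) → π ∈ₚ permutations n
∈-permutations zero    π = here λ ()
∈-permutations (suc n) π = Membership.∈-resp-≈ (permutationSetoid (suc n))
  {x = insert zero (π ⟨$⟩ʳ zero) (remove zero π)} {y = π} (insert-remove zero π)
  (Membership.∈-cartesianProductWith⁺
    (setoid _) (permutationSetoid n) (permutationSetoid (suc n))
    (λ {j} {k} {π} {σ} → insert-cong {j = j} {k} {π} {σ})
    (∈-allFin (π ⟨$⟩ʳ zero)) (∈-permutations n (remove zero π)))

permutations-unique : ∀ n → Uniqueₚ (permutations n)
permutations-unique zero    = All.[] AllPairs.∷ AllPairs.[]
permutations-unique (suc n) = Unique.cartesianProductWith⁺
  (setoid _) (permutationSetoid n) (permutationSetoid (suc n))
  (insert zero)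
  (λ {j} {k} {π} {σ} → insert-injective {j = j} {k} {π} {σ})
  (UniqueP.allFin⁺ (suc n)) (permutations-unique n)

module _ {n ℓ} (P : PosetOn n ℓ) where

  private
    inverse-cong : ∀ {π σ : Permutation′ n} → π ≈ₚ σ → ∀ i → π ⟨$⟩ˡ i ≡ σ ⟨$⟩ˡ i
    inverse-cong {π} {σ} p i = begin
      π ⟨$⟩ˡ i                        ≡⟨ inverseˡ σ ⟨
      σ ⟨$⟩ˡ (σ ⟨$⟩ʳ (π ⟨$⟩ˡ i))      ≡⟨ cong (σ ⟨$⟩ˡ_) (p (π ⟨$⟩ˡ i)) ⟨
      σ ⟨$⟩ˡ (π ⟨$⟩ʳ (π ⟨$⟩ˡ i))      ≡⟨ cong (σ ⟨$⟩ˡ_) (inverseʳ π) ⟩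
      σ ⟨$⟩ˡ i                        ∎

    resp : ∀ {π σ : Permutation′ n} → π ≈ₚ σ → IsLinearExtension P π → IsLinearExtension P σ
    resp {π} {σ} p l i j i≺j
      rewrite sym (inverse-cong {π} {σ} p i) | sym (inverse-cong {π} {σ} p j) = l i j i≺j

  ∈-linearExtensions : ∀ π → π ∈ₚ linearExtensions P ⇔ IsLinearExtension P π
  ∈-linearExtensions π = mk⇔
    (λ π∈ → proj₂ (Membership.∈-filter⁻ (permutationSetoid n) (isLinearExtension? P)
      (λ {π} {σ} → resp {π} {σ}) {v = π} {xs = permutations n} π∈))
    (Membership.∈-filter⁺ (permutationSetoid n) (isLinearExtension? P)
      (λ {π} {σ} → resp {π} {σ}) {v = π} (∈-permutations n π))

  linearExtensions-unique : Uniqueₚ (linearExtensions P)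
  linearExtensions-unique =
    Unique.filter⁺ (permutationSetoid n) (isLinearExtension? P) (permutations-unique n)

{-# OPTIONS --safe #-}

-- Promoting i in a linear extension of a forest moves every element of the chain
-- above i to the place of the next one, and the root to the end. Hence the preimage
-- under G_i of the set [a<b] of linear extensions with a before b is everything, or
-- nothing, or a set [a′<b′] with a ⪯ a′ and b ⪯ b′, which is [a<b] itself or has a
-- larger label sum a′ + b′. The same follows for every element of the monoid.
--
-- Let x = x f g, and let B be the preimage of some [u<v] under x. If B = [a<b] is not
-- constant, then either f fixes [a<b], or the preimage of [a<b] under f g, which is
-- again B, is constant or has the form [a′<b′] with a larger label sum. By induction
-- on the label sum, the preimage of B under f is B. As the sets [u<v] separate linear
-- extensions, x = x f.
module Submission where

open import Defs
open import Algebra.Bundles using (Monoid)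
import Algebra.Properties.Semiring.Sum as SemiringSum
open import Data.Bool.Base using (if_then_else_)
open import Data.Fin.Base using (Fin; zero; suc; toℕ; inject₁; fromℕ)
import Data.Fin.Base as Fin
import Data.Fin.Induction as Fin
open import Data.Fin.Permutation
  using (Permutation′; transpose; _∘ₚ_; _⟨$⟩ʳ_; _⟨$⟩ˡ_; inverseˡ; inverseʳ)
  renaming (_≈_ to _≈ₚ_)
import Data.Fin.Permutation.Components as Components
import Data.Fin.Properties as Fin
open import Data.List.Base
  using (List; []; _∷_; allFin; cartesianProductWith; filter; foldl; length; lookup; map; tabulate)
import Data.List.Membership.Propositional as Membership
import Data.List.Membership.Propositional.Properties as Membership
import Data.List.Membership.Setoid as SetoidMembership
import Data.List.Membership.Setoid.Properties as Membershipₛ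
import Data.List.Properties as List
import Data.List.Relation.Unary.All as All
import Data.List.Relation.Unary.All.Properties as All
open import Data.List.Relation.Unary.AllPairs using ([]; _∷_)
import Data.List.Relation.Unary.Any as Any
open import Data.List.Relation.Unary.Any using (here; there)
import Data.List.Relation.Unary.Any.Properties as Any
import Data.List.Relation.Unary.Unique.Setoid as UniqueSetoid
open import Data.Maybe.Base using (Maybe; just; nothing)
open import Data.Nat.Base using (ℕ; zero; suc; _+_; _*_; _≤_; _<_; z≤n; s≤s)
import Data.Nat.Properties as ℕ
open import Data.Product.Base using (∃; ∃-syntax; _×_; _,_; proj₁)
open import Data.Sum.Base using (_⊎_; inj₁; inj₂; [_,_]′)
open import Function.Base using (_∘_; id)
open import Function.Bundles using (_⇔_; mk⇔; Equivalence)
open import Function.Properties.Equivalence using ()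
  renaming (refl to ⇔-refl; sym to ⇔-sym; trans to ⇔-trans)
open import Induction.WellFounded using (Acc; acc)
open import Level using (Level)
open import Relation.Binary.Bundles using (Setoid)
open import Relation.Binary.PropositionalEquality
  using (_≡_; _≢_; _≗_; refl; sym; trans; cong; cong₂; subst; subst₂; module ≡-Reasoning)
open import Relation.Binary.Structures using (IsDecPartialOrder)
open import Relation.Nullary using (¬_; Dec; yes; no; contradiction)
open import Relation.Nullary.Decidable using (dec-true; dec-false; does-⇔; map′; _×-dec_)

open Equivalence using (to; from)

-- Opening a gap in the positions

-- `Gap k x y` says that y is x after a gap has been opened at k, as in `punchIn`.
data Gap (k : ℕ) : ℕ → ℕ → Set where
  below : ∀ {x} → x < k → Gap k x x
  above : ∀ {x} → k ≤ x → Gap k x (suc x)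

gap-mono-< : ∀ {k x x′ y y′} → Gap k x y → Gap k x′ y′ → x < x′ → y < y′
gap-mono-< (below _)   (below _)    x<x′ = x<x′
gap-mono-< (below _)   (above _)    x<x′ = ℕ.m<n⇒m<1+n x<x′
gap-mono-< (above k≤x) (below x′<k) x<x′ =
  contradiction (ℕ.≤-<-trans k≤x (ℕ.<-trans x<x′ x′<k)) (ℕ.<-irrefl refl)
gap-mono-< (above _)   (above _)    x<x′ = s≤s x<x′

gap-cancel-< : ∀ {k x x′ y y′} → Gap k x y → Gap k x′ y′ → y < y′ → x < x′
gap-cancel-< (below _)   (below _)    y<y′       = y<y′
gap-cancel-< (below x<k) (above k≤x′) _          = ℕ.<-≤-trans x<k k≤x′
gap-cancel-< (above k≤x) (below x′<k) 1+x<x′     =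
  contradiction (ℕ.≤-<-trans k≤x (ℕ.<-trans (ℕ.n<1+n _) (ℕ.<-trans 1+x<x′ x′<k))) (ℕ.<-irrefl refl)
gap-cancel-< (above _)   (above _)    (s≤s x<x′) = x<x′

-- The gap maps at k and k+1 differ only at k, which the first sends to k+1 and the second to k.
-- This lemma and `gap-move` thus pass from one gap to the other in the induction on positions.
gap-lower : ∀ {k x y} → Gap (suc k) x y → y ≢ k → Gap k x y
gap-lower (below x<1+k) x≢k = below (ℕ.≤∧≢⇒< (ℕ.≤-pred x<1+k) x≢k)
gap-lower (above k<x)   _   = above (ℕ.<⇒≤ k<x)

gap-move : ∀ {k x} → Gap (suc k) x k → Gap k x (suc k)
gap-move (below _)   = above ℕ.≤-refl
gap-move (above k<x) = contradiction (ℕ.<-trans (ℕ.n<1+n _) k<x) (ℕ.<-irrefl refl)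

-- The factors of promotion

private
  positionsFrom : ℕ → ∀ m → List (Fin m)
  positionsFrom k m = filter (λ i → k ℕ.≤? toℕ i) (allFin m)

  filter-map : ∀ {a b p} {A : Set a} {B : Set b} {P : B → Set p}
    (P? : ∀ x → Dec (P x)) (f : A → B) xs →
    filter P? (map f xs) ≡ map f (filter (P? ∘ f) xs)
  filter-map P? f []       = refl
  filter-map P? f (x ∷ xs) with P? (f x)
  ... | yes _ = cong (f x ∷_) (filter-map P? f xs)
  ... | no  _ = filter-map P? f xs

  positionsFrom-suc : ∀ k m → positionsFrom (suc k) (suc m) ≡ map suc (positionsFrom k m)
  positionsFrom-suc k m = begin
    filter (λ i → suc k ℕ.≤? toℕ i) (tabulate suc)
      ≡⟨ cong (filter _) (List.map-tabulate id suc) ⟨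
    filter (λ i → suc k ℕ.≤? toℕ i) (map suc (allFin m))
      ≡⟨ filter-map _ suc (allFin m) ⟩
    map suc (filter (λ i → suc k ℕ.≤? suc (toℕ i)) (allFin m))
      ≡⟨ cong (map suc) (List.filter-≐ _ _ (ℕ.≤-pred , s≤s) (allFin m)) ⟩
    map suc (positionsFrom k m) ∎
    where open ≡-Reasoning

  positionsFrom-zero : ∀ m → positionsFrom 0 m ≡ allFin m
  positionsFrom-zero m = List.filter-all _ (All.universal (λ _ → z≤n) (allFin m))

  positionsFrom-last : ∀ m → positionsFrom (toℕ (fromℕ m)) m ≡ []
  positionsFrom-last zero    = refl
  positionsFrom-last (suc m) = trans (positionsFrom-suc _ m) (cong (map suc) (positionsFrom-last m))

  positionsFrom-inject₁ : ∀ {m} (i : Fin m) →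
    positionsFrom (toℕ (inject₁ i)) m ≡ i ∷ positionsFrom (suc (toℕ i)) m
  positionsFrom-inject₁ {suc m} zero    = begin
    positionsFrom 0 (suc m)             ≡⟨ positionsFrom-zero (suc m) ⟩
    zero ∷ tabulate suc                 ≡⟨ cong (zero ∷_) (List.map-tabulate id suc) ⟨
    zero ∷ map suc (allFin m)           ≡⟨ cong (λ is → zero ∷ map suc is) (positionsFrom-zero m) ⟨
    zero ∷ map suc (positionsFrom 0 m)  ≡⟨ cong (zero ∷_) (positionsFrom-suc 0 m) ⟨
    zero ∷ positionsFrom 1 (suc m)      ∎
    where open ≡-Reasoning
  positionsFrom-inject₁ {suc m} (suc i) = begin
    positionsFrom (suc (toℕ (inject₁ i))) (suc m)     ≡⟨ positionsFrom-suc _ m ⟩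
    map suc (positionsFrom (toℕ (inject₁ i)) m)       ≡⟨ cong (map suc) (positionsFrom-inject₁ i) ⟩
    suc i ∷ map suc (positionsFrom (suc (toℕ i)) m)   ≡⟨ cong (suc i ∷_) (positionsFrom-suc _ m) ⟨
    suc i ∷ positionsFrom (suc (suc (toℕ i))) (suc m) ∎
    where open ≡-Reasoning

module _ {ℓ : Level} {m : ℕ} (P : PosetOn (suc m) ℓ) where

  -- With `∂-inject₁`, the base and the step of the downward induction on positions in
  -- `promotes-at`.
  ∂-last : ∀ π → ∂ P π (fromℕ m) ≡ π
  ∂-last π = cong (foldl (τ P) π) (positionsFrom-last m)

  ∂-inject₁ : ∀ π i → ∂ P π (inject₁ i) ≡ ∂ P (τ P π i) (suc i)
  ∂-inject₁ π i = cong (foldl (τ P) π) (positionsFrom-inject₁ i)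

-- Covers and chains in a rooted forest

module Forest {ℓ : Level} {n : ℕ} (P : PosetOn n ℓ)
  (forest : IsRootedForest (PosetOn.poset P))
  (natural : PosetOn.IsNaturallyLabelled P) where

  open PosetOn P
  open IsRootedForest forest
  private module ⪯ = IsDecPartialOrder isDecPartialOrder

  infix 4 _⋖_
  _⋖_ : Fin n → Fin n → Set ℓ
  _⋖_ = _IsCoveredBy_ poset

  -- Related elements share a colour, so both covers lie in the tree of `x`. They are covers there
  -- too, because an element between in the tree is between in the whole poset.
  ⋖-unique : ∀ {x y z} → x ⋖ y → x ⋖ z → y ≡ z
  ⋖-unique {x} {y} {z} (x≺y , ∄y) (x≺z , ∄z) =
    IsRootedTree.atMostOneCover (trees (colour x)) (x , refl)
      (y , sym (disjoint x y (proj₁ x≺y))) (z , sym (disjoint x z (proj₁ x≺z)))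
      (x≺y , λ { ((w , _) , x≺w , w≺y) → ∄y (w , x≺w , w≺y) })
      (x≺z , λ { ((w , _) , x≺w , w≺z) → ∄z (w , x≺w , w≺z) })

  -- Replace `y` by an element strictly between as long as there is one; by natural labelling the
  -- labels decrease.
  cover-below : ∀ {x y} → x ≺ y → ∃[ z ] (x ⋖ z × z ⪯ y)
  cover-below {x} {y} = go y (Fin.<-wellFounded y)
    where
    go : ∀ y → Acc Fin._<_ y → x ≺ y → ∃[ z ] (x ⋖ z × z ⪯ y)
    go y (acc rec) x≺y with Fin.any? (λ z → (x ≺? z) ×-dec (z ≺? y))
    ... | no ∄z = y , (x≺y , ∄z) , ⪯.refl
    ... | yes (z , x≺z , z≺y) with go z (rec (natural z y z≺y)) x≺z
    ...   | w , x⋖w , w⪯z = w , x⋖w , ⪯.trans w⪯z (proj₁ z≺y)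

  -- If neither element is `x`, both lie above its unique cover; induct upwards along the labels.
  above-comparable : ∀ {x y z} → x ⪯ y → x ⪯ z → Comparable y z
  above-comparable {x} = go x (Fin.>-wellFounded x)
    where
    go : ∀ x → Acc Fin._>_ x → ∀ {y z} → x ⪯ y → x ⪯ z → Comparable y z
    go x (acc rec) {y} {z} x⪯y x⪯z with x Fin.≟ y | x Fin.≟ z
    ... | yes refl | _        = inj₁ x⪯z
    ... | no  _    | yes refl = inj₂ x⪯y
    ... | no  x≢y  | no  x≢z with cover-below (x⪯y , x≢y) | cover-below (x⪯z , x≢z)
    ...   | u , x⋖u , u⪯y | v , x⋖v , v⪯z rewrite ⋖-unique x⋖u x⋖v =
      go v (rec (natural x v (proj₁ x⋖v))) u⪯y v⪯z

  -- When i is promoted, v takes the place (up to a gap) of t; `nothing` stands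
  -- for the end of the word.
  data Moves (i v : Fin n) : Maybe (Fin n) → Set ℓ where
    stays  : ¬ (i ⪯ v) → Moves i v (just v)
    climbs : ∀ {w} → i ⪯ v → v ⋖ w → Moves i v (just w)
    leaves : i ⪯ v → (∀ w → ¬ (v ≺ w)) → Moves i v nothing

  moves-total : ∀ i v → ∃ (Moves i v)
  moves-total i v with i ⪯? v
  ... | no  i⋠v = just v , stays i⋠v
  ... | yes i⪯v with Fin.any? (v ≺?_)
  ...   | no  ∄w        = nothing , leaves i⪯v (λ w v≺w → ∄w (w , v≺w))
  ...   | yes (_ , v≺y) with cover-below v≺y
  ...     | w , v⋖w , _ = just w , climbs i⪯v v⋖w

  -- The place of `i` itself is taken by no entry, which gives the inequality that `gap-lower` and
  -- `gap-swap` ask for.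
  moves-≢ : ∀ {i v w} → Moves i v (just w) → i ≢ w
  moves-≢ (stays i⋠v)                        refl = i⋠v ⪯.refl
  moves-≢ (climbs i⪯v ((v⪯i , v≢i) , _)) refl = v≢i (⪯.antisym v⪯i i⪯v)

  place : Permutation′ n → Maybe (Fin n) → ℕ
  place π (just w) = toℕ (π ⟨$⟩ˡ w)
  -- One past the last position, hence after the place of every entry.
  place π nothing  = n

-- Exchange of adjacent positions

data SwapView {m} (i : Fin m) : Fin (suc m) → Fin (suc m) → Set where
  left  : SwapView i (inject₁ i) (suc i)
  right : SwapView i (suc i) (inject₁ i)
  other : ∀ {x} → x ≢ inject₁ i → x ≢ suc i → SwapView i x x

-- The inverse of `transpose (inject₁ i) (suc i)` has its arguments in this order, and it is the
-- inverse that acts on the positions of entries.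
swapView : ∀ {m} (i : Fin m) x → SwapView i x (Components.transpose (suc i) (inject₁ i) x)
swapView i x with x Fin.≟ suc i
... | yes refl = right
... | no x≢r with x Fin.≟ inject₁ i
...   | yes refl = left
...   | no x≢l   = other x≢l x≢r

-- No position lies strictly between the two exchanged ones, so theirs is the only order that is
-- reversed.
swap-mono-< : ∀ {m} {i : Fin m} {x y x′ y′} → SwapView i x x′ → SwapView i y y′ →
  ¬ (x ≡ inject₁ i × y ≡ suc i) → x Fin.< y → x′ Fin.< y′
swap-mono-< left left ¬lr x<y = contradiction x<y (ℕ.<-irrefl refl)
swap-mono-< left right ¬lr x<y = contradiction (refl , refl) ¬lr
swap-mono-< {i = i} left (other y≢l y≢r) ¬lr x<y =
  ℕ.≤∧≢⇒< (subst (_< _) (Fin.toℕ-inject₁ i) x<y) (y≢r ∘ sym ∘ Fin.toℕ-injective)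
swap-mono-< {i = i} right left ¬lr x<y =
  subst (_< suc (toℕ i)) (sym (Fin.toℕ-inject₁ i)) (ℕ.n<1+n _)
swap-mono-< right right ¬lr x<y = contradiction x<y (ℕ.<-irrefl refl)
swap-mono-< {i = i} right (other _ _) ¬lr x<y =
  subst (_< _) (sym (Fin.toℕ-inject₁ i)) (ℕ.<-trans (ℕ.n<1+n _) x<y)
swap-mono-< {i = i} (other _ _) left ¬lr x<y =
  ℕ.m<n⇒m<1+n (subst (_ <_) (Fin.toℕ-inject₁ i) x<y)
swap-mono-< (other x≢l _) right ¬lr x<y =
  ℕ.≤∧≢⇒< (subst (_ ≤_) (sym (Fin.toℕ-inject₁ _)) (ℕ.≤-pred x<y)) (x≢l ∘ Fin.toℕ-injective)
swap-mono-< (other _ _) (other _ _) ¬lr x<y = x<y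

swap-left : ∀ {m} {i : Fin m} {y} → SwapView i (inject₁ i) y → y ≡ suc i
swap-left {i = i} v = go v refl
  where
  go : ∀ {x y} → SwapView i x y → x ≡ inject₁ i → y ≡ suc i
  go left          _   = refl
  go right         eq  = contradiction (trans (cong toℕ eq) (Fin.toℕ-inject₁ i)) ℕ.1+n≢n
  go (other x≢l _) x≡l = contradiction x≡l x≢l

-- Here `y` and `y′` are the positions of one entry before and after the exchange. As the entry does
-- not start at i, it either comes from i+1 to i, where `gap-move` applies, or stays put away from
-- i.
gap-swap : ∀ {m} {i : Fin m} {x y y′} → SwapView i y y′ → y ≢ inject₁ i →
  Gap (suc (toℕ i)) x (toℕ y′) → Gap (toℕ i) x (toℕ y)
gap-swap         left        y≢l _   = contradiction refl y≢l
gap-swap         right       _   gap = gap-move (subst (Gap _ _) (Fin.toℕ-inject₁ _) gap)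
gap-swap {i = i} (other _ _) y≢l gap = gap-lower gap λ y≡i →
  y≢l (Fin.toℕ-injective (trans y≡i (sym (Fin.toℕ-inject₁ i))))

at-position : ∀ {n} (π : Permutation′ n) {v k} → π ⟨$⟩ˡ v ≡ k → v ≡ π ⟨$⟩ʳ k
at-position π refl = sym (inverseʳ π)

-- Promotion preserves linear extensions

module _ {ℓ : Level} {m : ℕ} (P : PosetOn (suc m) ℓ) where
  open PosetOn P

  exchange : Permutation′ (suc m) → Fin m → Permutation′ (suc m)
  exchange π i = transpose (inject₁ i) (suc i) ∘ₚ π

  τ-comparable : ∀ π i → Comparable (π ⟨$⟩ʳ inject₁ i) (π ⟨$⟩ʳ suc i) → τ P π i ≡ π
  τ-comparable π i c~d =
    cong (if_then π else exchange π i) (dec-true (comparable? _ _) c~d)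

  τ-incomparable : ∀ π i → ¬ Comparable (π ⟨$⟩ʳ inject₁ i) (π ⟨$⟩ʳ suc i) →
    τ P π i ≡ exchange π i
  τ-incomparable π i c≁d =
    cong (if_then π else exchange π i) (dec-false (comparable? _ _) c≁d)

  exchange-isLinearExtension : ∀ π i → ¬ Comparable (π ⟨$⟩ʳ inject₁ i) (π ⟨$⟩ʳ suc i) →
    IsLinearExtension P π → IsLinearExtension P (exchange π i)
  exchange-isLinearExtension π i c≁d lin a b a≺b =
    swap-mono-< (swapView i _) (swapView i _)
      (λ { (a-left , b-right) → c≁d
        (inj₁ (subst₂ _⪯_ (at-position π a-left) (at-position π b-right) (proj₁ a≺b))) })
      (lin a b a≺b)

  τ-isLinearExtension : ∀ π i → IsLinearExtension P π → IsLinearExtension P (τ P π i)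
  τ-isLinearExtension π i lin with comparable? (π ⟨$⟩ʳ inject₁ i) (π ⟨$⟩ʳ suc i)
  ... | yes c~d = subst (IsLinearExtension P) (sym (τ-comparable π i c~d)) lin
  ... | no  c≁d = subst (IsLinearExtension P) (sym (τ-incomparable π i c≁d))
    (exchange-isLinearExtension π i c≁d lin)

∂-isLinearExtension : ∀ {ℓ n} (P : PosetOn n ℓ) π j →
  IsLinearExtension P π → IsLinearExtension P (∂ P π j)
∂-isLinearExtension {n = suc m} P π j = go π (filter (λ i → toℕ j ℕ.≤? toℕ i) (allFin m))
  where
  go : ∀ π is → IsLinearExtension P π → IsLinearExtension P (foldl (τ P) π is)
  go π []       lin = lin
  go π (i ∷ is) lin = go (τ P π i) is (τ-isLinearExtension P π i lin)

-- Positions after a promotion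

module Promotion {ℓ : Level} {m : ℕ} (P : PosetOn (suc m) ℓ)
  (forest : IsRootedForest (PosetOn.poset P))
  (natural : PosetOn.IsNaturallyLabelled P) where

  open PosetOn P
  open Forest P forest natural
  private module ⪯ = IsDecPartialOrder isDecPartialOrder

  private
    -- Position k is emptied and the word closes up, so new positions become old places once the gap
    -- at k is reopened.
    Promotes : Fin (suc m) → Set _
    Promotes k = ∀ π → IsLinearExtension P π → ∀ {v t} → Moves (π ⟨$⟩ʳ k) v t →
      Gap (toℕ k) (toℕ (∂ P π k ⟨$⟩ˡ v)) (place π t)

    promotes-last : Promotes (fromℕ m)
    promotes-last π lin mv rewrite ∂-last P π = go mv
      where
      last : π ⟨$⟩ˡ (π ⟨$⟩ʳ fromℕ m) ≡ fromℕ m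
      last = inverseˡ π
      maximal : ∀ w → ¬ (π ⟨$⟩ʳ fromℕ m ≺ w)
      maximal w c≺w = contradiction
        (subst (Fin._< (π ⟨$⟩ˡ w)) last (lin _ w c≺w))
        (ℕ.≤⇒≯ (Fin.≤fromℕ (π ⟨$⟩ˡ w)))
      go : ∀ {v t} → Moves (π ⟨$⟩ʳ fromℕ m) v t →
        Gap (toℕ (fromℕ m)) (toℕ (π ⟨$⟩ˡ v)) (place π t)
      go (stays c⋠v) = below (ℕ.≤∧≢⇒< (Fin.≤fromℕ _) λ eq →
        c⋠v (⪯.reflexive (sym (at-position π (Fin.toℕ-injective eq)))))
      -- The last entry of a linear extension is maximal, so nothing climbs.
      go {v} (climbs {w} c⪯v (v≺w , _)) with π ⟨$⟩ʳ fromℕ m Fin.≟ v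
      ... | yes refl = contradiction v≺w (maximal w)
      ... | no  c≢v  = contradiction (c⪯v , c≢v) (maximal v)
      go {v} (leaves c⪯v _) with π ⟨$⟩ʳ fromℕ m Fin.≟ v
      ... | no  c≢v  = contradiction (c⪯v , c≢v) (maximal v)
      -- The promoted entry keeps the last position m, and the gap there pushes it to the end m+1.
      ... | yes refl rewrite last =
        subst (λ x → Gap x x (suc m)) (sym (Fin.toℕ-fromℕ m)) (above ℕ.≤-refl)

    -- Let c and d be the entries at i and i+1. If they are comparable, the word is unchanged and d
    -- is promoted next: whatever is strictly above c is above d, and c takes the place of d. If
    -- not, c passes to i+1 and its promotion continues from there.
    promotes-step : ∀ i → Promotes (suc i) → Promotes (inject₁ i)
    promotes-step i ih π lin mv
      rewrite ∂-inject₁ P π i | Fin.toℕ-inject₁ i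
      with comparable? (π ⟨$⟩ʳ inject₁ i) (π ⟨$⟩ʳ suc i)
    ... | yes c~d rewrite τ-comparable P π i c~d = go mv
      where
      c = π ⟨$⟩ʳ inject₁ i
      d = π ⟨$⟩ʳ suc i
      c-pos : toℕ (π ⟨$⟩ˡ c) ≡ toℕ i
      c-pos = trans (cong toℕ (inverseˡ π)) (Fin.toℕ-inject₁ i)
      d-pos : toℕ (π ⟨$⟩ˡ d) ≡ suc (toℕ i)
      d-pos = cong toℕ (inverseˡ π)
      off-c : ∀ {w} → c ≢ w → toℕ (π ⟨$⟩ˡ w) ≢ toℕ i
      off-c c≢w eq = c≢w (sym (at-position π
        (Fin.toℕ-injective (trans eq (sym (Fin.toℕ-inject₁ i))))))
      c≢d : c ≢ d
      c≢d eq = ℕ.1+n≢n (trans (sym d-pos) (trans (cong (toℕ ∘ (π ⟨$⟩ˡ_)) (sym eq)) c-pos))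
      c≺d : c ≺ d
      c≺d = [ (λ c⪯d → c⪯d , c≢d)
            , (λ d⪯c → contradiction (lin d c (d⪯c , c≢d ∘ sym))
                (ℕ.<-asym (subst₂ _<_ (sym c-pos) (sym d-pos) (ℕ.n<1+n _))))
            ]′ c~d
      -- Nothing fits between the adjacent entries c and d.
      d⪯ : ∀ {w} → c ≺ w → d ⪯ w
      d⪯ {w} c≺w with d Fin.≟ w | above-comparable (proj₁ c≺d) (proj₁ c≺w)
      ... | yes refl | _        = ⪯.refl
      ... | no _     | inj₁ d⪯w = d⪯w
      ... | no d≢w   | inj₂ w⪯d = contradiction
        (ℕ.<-≤-trans (subst (_< _) c-pos (lin c w c≺w))
          (ℕ.≤-pred (subst (_ <_) d-pos (lin w d (w⪯d , d≢w ∘ sym)))))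
        (ℕ.<-irrefl refl)
      go : ∀ {v t} → Moves c v t → Gap (toℕ i) (toℕ (∂ P π (suc i) ⟨$⟩ˡ v)) (place π t)
      go mv@(stays c⋠v) =
        gap-lower (ih π lin (stays (c⋠v ∘ ⪯.trans (proj₁ c≺d)))) (off-c (moves-≢ mv))
      go {v} mv@(climbs {w} c⪯v v⋖w@(v≺w , ∄w)) with c Fin.≟ v
      ... | no c≢v = gap-lower (ih π lin (climbs (d⪯ (c⪯v , c≢v)) v⋖w)) (off-c (moves-≢ mv))
      ... | yes refl with d Fin.≟ w
      -- Otherwise d would lie strictly between c and its cover.
      ...   | no d≢w = contradiction (d , c≺d , d⪯ v≺w , d≢w) ∄w
      -- While d is promoted c stays at i; moving the gap from i+1 to i turns this into i+1, the
      -- place of d.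
      ...   | yes refl = subst (Gap _ _) (sym d-pos)
        (gap-move (subst (Gap _ _) c-pos
          (ih π lin (stays λ d⪯c → c≢d (⪯.antisym (proj₁ c≺d) d⪯c)))))
      go {v} (leaves c⪯v max) with c Fin.≟ v
      ... | no c≢v = gap-lower (ih π lin (leaves (d⪯ (c⪯v , c≢v)) max))
        (ℕ.>⇒≢ (ℕ.m<n⇒m<1+n (Fin.toℕ<n i)))
      ... | yes refl = contradiction c≺d (max d)
    ... | no c≁d rewrite τ-incomparable P π i c≁d =
      -- In the exchanged word `ρ` the entry at i+1 is c, so the induction hypothesis again promotes
      -- c.
      go mv (ih ρ (exchange-isLinearExtension P π i c≁d lin)
        (subst (λ c → Moves c _ _) (sym ρ-c) mv))
      where
      ρ = exchange P π i
      c = π ⟨$⟩ʳ inject₁ i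
      ρ-pos : ρ ⟨$⟩ˡ c ≡ suc i
      ρ-pos rewrite inverseˡ π {inject₁ i} = swap-left (swapView i (inject₁ i))
      ρ-c : ρ ⟨$⟩ʳ suc i ≡ c
      ρ-c = sym (at-position ρ ρ-pos)
      off-c : ∀ {w} → c ≢ w → π ⟨$⟩ˡ w ≢ inject₁ i
      off-c c≢w = c≢w ∘ sym ∘ at-position π
      go : ∀ {v t} → Moves c v t → Gap (suc (toℕ i)) (toℕ (∂ P ρ (suc i) ⟨$⟩ˡ v)) (place ρ t) →
        Gap (toℕ i) (toℕ (∂ P ρ (suc i) ⟨$⟩ˡ v)) (place π t)
      go {t = nothing} _ gap = gap-lower gap (ℕ.>⇒≢ (ℕ.m<n⇒m<1+n (Fin.toℕ<n i)))
      go {t = just w} mv gap = gap-swap (swapView i _) (off-c (moves-≢ mv)) gap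

  promotes-at : ∀ k → Promotes k
  promotes-at = Fin.>-weakInduction Promotes promotes-last promotes-step

promotes : ∀ {ℓ n} (P : PosetOn n ℓ) forest natural π → IsLinearExtension P π →
  ∀ i {v t} → Forest.Moves P forest natural i v t →
  Gap (toℕ (π ⟨$⟩ˡ i)) (toℕ (∂ P π (π ⟨$⟩ˡ i) ⟨$⟩ˡ v)) (Forest.place P forest natural π t)
promotes {n = suc m} P forest natural π lin i mv = promotes-at (π ⟨$⟩ˡ i) π lin
  (subst (λ c → Moves c _ _) (sym (inverseʳ π)) mv)
  where
  open Forest P forest natural
  open Promotion P forest natural

-- Finiteness of a finitely generated submonoid

module _ {a ℓ} (S : Setoid a ℓ) where
  open Setoid S using (_≈_)
  open UniqueSetoid S using (Unique)

  lookup-injective : ∀ {xs} → Unique xs → ∀ i j → lookup xs i ≈ lookup xs j → i ≡ j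
  lookup-injective (_ ∷ _)  zero    zero    _  = refl
  lookup-injective (x∉ ∷ _) zero    (suc j) eq =
    contradiction eq (All.lookup x∉ (Membership.∈-lookup j))
  lookup-injective (x∉ ∷ _) (suc i) zero    eq =
    contradiction (Setoid.sym S eq) (All.lookup x∉ (Membership.∈-lookup i))
  lookup-injective (_ ∷ u)  (suc i) (suc j) eq = cong suc (lookup-injective u i j eq)

module _ {c ℓ} (M : Monoid c ℓ) {n : ℕ} (gen : Fin n → Monoid.Carrier M) where
  private
    M′ = generatedSubmonoid M gen
    module M = Monoid M
  open Monoid M′ hiding (refl; sym; trans)
  open SetoidMembership setoid using (_∈_)
  open UniqueSetoid setoid using (Unique)

  private
    extensions : List Carrier → List Carrier
    extensions xs = cartesianProductWith (λ x i → x ∙ (gen i , generator i)) xs (allFin n)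

  -- By induction on its derivation, every element maps the list into itself by right
  -- multiplication; apply this to `ε`.
  closed⇒enumerates : ∀ {xs} → ε ∈ xs → All.All (_∈ xs) (extensions xs) → ∀ x → x ∈ xs
  closed⇒enumerates {xs} ε∈ closed (x , p) =
    Membershipₛ.∈-resp-≈ setoid {x = ε ∙ (x , p)} {y = x , p} (M.identityˡ x) (go p ε ε∈)
    where
    go : ∀ {x} (p : Generated M gen x) y → y ∈ xs → y ∙ (x , p) ∈ xs
    go (generator i) y y∈ with Membership.find y∈
    ... | z , z∈ , y≈z = Membershipₛ.∈-resp-≈ setoid
      {x = z ∙ (gen i , generator i)} {y = y ∙ (gen i , generator i)} (M.∙-congʳ (M.sym y≈z))
      (All.lookup closed (Membership.∈-cartesianProductWith⁺ _ z∈ (Membership.∈-allFin i)))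
    go unit          y y∈ = Membershipₛ.∈-resp-≈ setoid
      {x = y} {y = y ∙ ε} (M.sym (M.identityʳ (proj₁ y))) y∈
    go (product {x₁} {x₂} p q) y y∈ = Membershipₛ.∈-resp-≈ setoid
      {x = y ∙ (x₁ , p) ∙ (x₂ , q)} {y = y ∙ (x₁ M.∙ x₂ , product p q)}
      (M.assoc (proj₁ y) x₁ x₂) (go q (y ∙ (x₁ , p)) (go p y y∈))

  -- The codes serve twice: they decide equality in the submonoid and bound the length of a list
  -- without repetition.
  module _ {K : ℕ} (code : Carrier → Fin K)
    (code-cong : ∀ {x y} → x ≈ y → code x ≡ code y)
    (code-injective : ∀ {x y} → code x ≡ code y → x ≈ y) where

    private
      _∈?_ : ∀ x xs → Dec (x ∈ xs)
      x ∈? xs = Any.any?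
        (λ y → map′ (code-injective {x} {y}) (code-cong {x} {y}) (code x Fin.≟ code y)) xs

    length≤ : ∀ {xs} → Unique xs → length xs ≤ K
    length≤ {xs} unique = Fin.injective⇒≤ {f = code ∘ lookup xs} λ {i} {j} eq →
      lookup-injective setoid unique i j (code-injective eq)

    generatedSubmonoid-finite : Finite setoid
    generatedSubmonoid-finite = saturate K (ε ∷ []) (All.[] ∷ []) (here M.refl) (ℕ.m≤m+n K 1)
      where
      -- Each round adjoins a missing product; the codes bound the number of rounds.
      saturate : ∀ k xs → Unique xs → ε ∈ xs → K ≤ k + length xs → Finite setoid
      saturate k xs unique ε∈ K≤ with All.all? (_∈? xs) (extensions xs)
      ... | yes closed = xs , closed⇒enumerates ε∈ closed
      ... | no ¬closed with Membership.find (All.¬All⇒Any¬ (_∈? xs) _ ¬closed)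
      ...   | y , _ , y∉ with k
      ...     | zero   = contradiction
        (ℕ.≤-trans (length≤ {y ∷ xs} (All.¬Any⇒All¬ xs y∉ ∷ unique)) K≤) (ℕ.<-irrefl refl)
      ...     | suc k′ = saturate k′ (y ∷ xs) (All.¬Any⇒All¬ xs y∉ ∷ unique) (there ε∈)
        (subst (K ≤_) (sym (ℕ.+-suc k′ (length xs))) K≤)

-- Atoms and their preimages

module Atoms {S E : Set} (⟦_⟧ : E → S → Set) (rank : E → ℕ) where

  data Raised (f : S → S) (e : E) : Set where
    raised : ∀ {e′} → rank e < rank e′ → (∀ s → ⟦ e ⟧ (f s) ⇔ ⟦ e′ ⟧ s) → Raised f e
    always : (∀ s → ⟦ e ⟧ (f s)) → Raised f e
    never  : (∀ s → ¬ ⟦ e ⟧ (f s)) → Raised f e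

  Outcome : (S → S) → E → Set
  Outcome f e = (∀ s → ⟦ e ⟧ (f s) ⇔ ⟦ e ⟧ s) ⊎ Raised f e

  -- The preimage under `f ∘ g` is the preimage under `g` of the one under `f`, and `g` never lowers
  -- a rank.
  raised-∘ : ∀ {f g e} → Raised f e → (∀ e → Outcome g e) → Raised (f ∘ g) e
  raised-∘ {g = g} (raised {e′} e<e′ h) outcome-g with outcome-g e′
  ... | inj₁ h′                 = raised e<e′ λ s → ⇔-trans (h (g s)) (h′ s)
  ... | inj₂ (raised e′<e″ h′) = raised (ℕ.<-trans e<e′ e′<e″) λ s → ⇔-trans (h (g s)) (h′ s)
  ... | inj₂ (always h′)        = always λ s → from (h (g s)) (h′ s)
  ... | inj₂ (never h′)         = never λ s → h′ s ∘ to (h (g s))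
  raised-∘ {g = g} (always h) _ = always (h ∘ g)
  raised-∘ {g = g} (never h)  _ = never (h ∘ g)

  outcome-∘ : ∀ {f g} → (∀ e → Outcome f e) → (∀ e → Outcome g e) → ∀ e → Outcome (f ∘ g) e
  outcome-∘ {g = g} outcome-f outcome-g e with outcome-f e
  ... | inj₂ r = inj₂ (raised-∘ r outcome-g)
  ... | inj₁ h with outcome-g e
  ...   | inj₁ h′               = inj₁ λ s → ⇔-trans (h (g s)) (h′ s)
  ...   | inj₂ (raised e<e′ h′) = inj₂ (raised e<e′ λ s → ⇔-trans (h (g s)) (h′ s))
  ...   | inj₂ (always h′)      = inj₂ (always λ s → from (h (g s)) (h′ s))
  ...   | inj₂ (never h′)       = inj₂ (never λ s → h′ s ∘ to (h (g s)))

  outcome-id : ∀ e → Outcome id e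
  outcome-id e = inj₁ λ _ → ⇔-refl

  module _ {K : ℕ} (rank≤ : ∀ e → rank e ≤ K) {f g : S → S}
    (outcome-f : ∀ e → Outcome f e) (outcome-g : ∀ e → Outcome g e) where

    -- Unless f fixes e, invariance of B under f ∘ g replaces e by an atom of higher
    -- rank describing B, or shows that B is constant.
    atom-invariant : ∀ {B : S → Set} → (∀ s → B (f (g s)) ⇔ B s) →
      ∀ e → (∀ s → B s ⇔ ⟦ e ⟧ s) → ∀ s → B (f s) ⇔ B s
    atom-invariant {B} inv e = go K e (ℕ.m≤m+n K (rank e))
      where
      -- Since no rank exceeds `K`, at most `k` further rises are possible.
      go : ∀ k e → K ≤ k + rank e → (∀ s → B s ⇔ ⟦ e ⟧ s) → ∀ s → B (f s) ⇔ B s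
      go k e K≤ B⇔e s with outcome-f e
      ... | inj₁ h = ⇔-trans (B⇔e (f s)) (⇔-trans (h s) (⇔-sym (B⇔e s)))
      ... | inj₂ r with raised-∘ r outcome-g
      ...   | always h = mk⇔ (λ _ → all s) (λ _ → all (f s))
        where
        all : ∀ s → B s
        all s = to (inv s) (from (B⇔e _) (h s))
      ...   | never h = mk⇔ (λ b → contradiction b (none (f s))) (λ b → contradiction b (none s))
        where
        none : ∀ s → ¬ B s
        none s b = h s (to (B⇔e _) (from (inv s) b))
      ...   | raised {e′} e<e′ h with k
      ...     | zero   = contradiction (ℕ.≤-trans e<e′ (ℕ.≤-trans (rank≤ e′) K≤)) (ℕ.<-irrefl refl)
      ...     | suc k′ = go k′ e′
        (ℕ.≤-trans K≤ (subst (_≤ k′ + rank e′) (ℕ.+-suc k′ (rank e)) (ℕ.+-monoʳ-≤ k′ e<e′)))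
        (λ s → ⇔-trans (⇔-sym (inv s)) (⇔-trans (B⇔e _) (h s))) s

    -- The set B is the preimage of `⟦ e ⟧` under `h`. The outcome says that B is constant or is
    -- itself described by an atom, to which `atom-invariant` applies.
    preimage-invariant : ∀ {h : S → S} {e} → Outcome h e → (∀ s → h (f (g s)) ≡ h s) →
      ∀ s → ⟦ e ⟧ (h (f s)) ⇔ ⟦ e ⟧ (h s)
    preimage-invariant {h} {e} o inv = go o
      where
      inv′ : ∀ s → ⟦ e ⟧ (h (f (g s))) ⇔ ⟦ e ⟧ (h s)
      inv′ s = mk⇔ (subst ⟦ e ⟧ (inv s)) (subst ⟦ e ⟧ (sym (inv s)))
      go : Outcome h e → ∀ s → ⟦ e ⟧ (h (f s)) ⇔ ⟦ e ⟧ (h s)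
      go (inj₁ p)                   = atom-invariant inv′ e p
      go (inj₂ (raised {e′} _ p)) = atom-invariant inv′ e′ p
      go (inj₂ (always p)) s = mk⇔ (λ _ → p s) (λ _ → p (f s))
      go (inj₂ (never p))  s = mk⇔ (λ b → contradiction b (p (f s))) (λ b → contradiction b (p s))

-- Matrices of maps

𝟙-≡ : ∀ {N} {a b : Fin N} → 𝟙 a a ≡ 𝟙 a b → a ≡ b
𝟙-≡ {a = a} {b} eq with a Fin.≟ b
... | yes a≡b = a≡b
... | no  _   with a Fin.≟ a
...   | yes _  = contradiction eq λ ()
...   | no a≢a = contradiction refl a≢a

Represents : ∀ {N} → Matrix N → (Fin N → Fin N) → Set
Represents A f = ∀ r s → A r s ≡ 𝟙 r (f s)

-- Column `s` of `B` is column `g s` of the identity, so column `s` of the product is column `g s`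
-- of `A`.
represents-∘ : ∀ {N} {A B : Matrix N} {f g} → Represents A f → Represents B g →
  Represents (A ⊗ B) (f ∘ g)
represents-∘ {N} {A} {B} {f} {g} A~f B~g r s = begin
  (A ⊗ B) r s      ≡⟨ sum-cong-≗ (λ t → cong (A r t *_) (B~g t s)) ⟩
  (A ⊗ 𝟙) r (g s)  ≡⟨ Monoid.identityʳ (matrixMonoid N) A r (g s) ⟩
  A r (g s)        ≡⟨ A~f r (g s) ⟩
  𝟙 r (f (g s))    ∎
  where
  open ≡-Reasoning
  open SemiringSum ℕ.+-*-semiring using (sum-cong-≗)

represents-≗ : ∀ {N} {A B : Matrix N} {f g} → Represents A f → Represents B g → A ≋ B → f ≗ g
represents-≗ {f = f} A~f B~g A≋B s =
  𝟙-≡ (trans (sym (A~f (f s) s)) (trans (A≋B (f s) s) (B~g (f s) s)))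

represents-≋ : ∀ {N} {A B : Matrix N} {f g} → Represents A f → Represents B g → f ≗ g → A ≋ B
represents-≋ A~f B~g f≗g r s = trans (A~f r s) (trans (cong (𝟙 r) (f≗g s)) (sym (B~g r s)))

funToFin-cong : ∀ {m n} {f g : Fin m → Fin n} → f ≗ g → Fin.funToFin f ≡ Fin.funToFin g
funToFin-cong {zero}  f≗g = refl
funToFin-cong {suc m} f≗g = cong₂ Fin.combine (f≗g zero) (funToFin-cong (f≗g ∘ suc))

funToFin-injective : ∀ {m n} {f g : Fin m → Fin n} → Fin.funToFin f ≡ Fin.funToFin g → f ≗ g
funToFin-injective {f = f} {g} eq i = begin
  f i                              ≡⟨ Fin.finToFun-funToFin f i ⟨
  Fin.finToFun (Fin.funToFin f) i  ≡⟨ cong (λ k → Fin.finToFun k i) eq ⟩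
  Fin.finToFun (Fin.funToFin g) i  ≡⟨ Fin.finToFun-funToFin g i ⟩
  g i                              ∎
  where open ≡-Reasoning

module Action {N n : ℕ} (gen : Fin n → Matrix N) (move : Fin n → Fin N → Fin N)
  (gen~move : ∀ i → Represents (gen i) (move i)) where

  private Gen = Generated (matrixMonoid N) gen

  act : ∀ {A} → Gen A → Fin N → Fin N
  act (generator i) = move i
  act unit          = id
  act (product p q) = act p ∘ act q

  act-represents : ∀ {A} (p : Gen A) → Represents A (act p)
  act-represents (generator i) = gen~move i
  act-represents unit          = λ _ _ → refl
  act-represents (product p q) = represents-∘ (act-represents p) (act-represents q)

  -- A matrix in the monoid and the map it represents determine each other, and `funToFin` encodes
  -- the finitely many self-maps of `Fin N`.
  finite : Finite (Monoid.setoid (generatedSubmonoid (matrixMonoid N) gen))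
  finite = generatedSubmonoid-finite (matrixMonoid N) gen
    (λ { (_ , p) → Fin.funToFin (act p) })
    (λ { {_ , p} {_ , q} A≋B →
      funToFin-cong (represents-≗ (act-represents p) (act-represents q) A≋B) })
    (λ { {_ , p} {_ , q} eq →
      represents-≋ (act-represents p) (act-represents q) (funToFin-injective eq) })

-- Permutations determined by the order of their entries

mono⇒inflationary : ∀ {n} (f : Fin n → Fin n) → (∀ i j → i Fin.< j → f i Fin.< f j) →
  ∀ i → i Fin.≤ f i
mono⇒inflationary {suc n} f mono = Fin.<-weakInduction (λ i → i Fin.≤ f i) z≤n λ i i≤fi →
  ℕ.≤-<-trans (subst (_≤ toℕ (f (inject₁ i))) (Fin.toℕ-inject₁ i) i≤fi)
    (mono (inject₁ i) (suc i) (s≤s (ℕ.≤-reflexive (Fin.toℕ-inject₁ i))))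

-- Both composites of one permutation with the inverse of the other are strictly increasing, hence
-- inflationary. Being mutually inverse, they are the identity.
order-determines : ∀ {n} (π σ : Permutation′ n) →
  (∀ u v → (π ⟨$⟩ˡ u) Fin.< (π ⟨$⟩ˡ v) ⇔ (σ ⟨$⟩ˡ u) Fin.< (σ ⟨$⟩ˡ v)) → π ≈ₚ σ
order-determines π σ same i = sym (trans (cong (σ ⟨$⟩ʳ_) (sym fixed)) (inverseʳ σ))
  where
  i≤ : ∀ i → i Fin.≤ (σ ⟨$⟩ˡ (π ⟨$⟩ʳ i))
  i≤ = mono⇒inflationary _ λ i j i<j →
    to (same (π ⟨$⟩ʳ i) (π ⟨$⟩ʳ j))
      (subst₂ Fin._<_ (sym (inverseˡ π {i})) (sym (inverseˡ π {j})) i<j)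
  j≤ : ∀ j → j Fin.≤ (π ⟨$⟩ˡ (σ ⟨$⟩ʳ j))
  j≤ = mono⇒inflationary _ λ i j i<j →
    from (same (σ ⟨$⟩ʳ i) (σ ⟨$⟩ʳ j))
      (subst₂ Fin._<_ (sym (inverseˡ σ {i})) (sym (inverseˡ σ {j})) i<j)
  fixed : σ ⟨$⟩ˡ (π ⟨$⟩ʳ i) ≡ i
  fixed = Fin.≤-antisym
    (subst ((σ ⟨$⟩ˡ (π ⟨$⟩ʳ i)) Fin.≤_)
      (trans (cong (π ⟨$⟩ˡ_) (inverseʳ σ)) (inverseˡ π)) (j≤ (σ ⟨$⟩ˡ (π ⟨$⟩ʳ i))))
    (i≤ i)

inverse-cong : ∀ {n} (π σ : Permutation′ n) → π ≈ₚ σ → ∀ v → π ⟨$⟩ˡ v ≡ σ ⟨$⟩ˡ v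
inverse-cong π σ π≈σ v = begin
  π ⟨$⟩ˡ v                    ≡⟨ inverseˡ σ ⟨
  σ ⟨$⟩ˡ (σ ⟨$⟩ʳ (π ⟨$⟩ˡ v))  ≡⟨ cong (σ ⟨$⟩ˡ_) (π≈σ (π ⟨$⟩ˡ v)) ⟨
  σ ⟨$⟩ˡ (π ⟨$⟩ʳ (π ⟨$⟩ˡ v))  ≡⟨ cong (σ ⟨$⟩ˡ_) (inverseʳ π) ⟩
  σ ⟨$⟩ˡ v                    ∎
  where open ≡-Reasoning

-- The promotion monoid acting on linear extensions

module _ {ℓ : Level} {n : ℕ} (P : PosetOn n ℓ) where

  private
    N = length (linearExtensions P)

    extension : Fin N → Permutation′ n
    extension = lookup (linearExtensions P)

    extension-isLinearExtension : ∀ s → IsLinearExtension P (extension s)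
    extension-isLinearExtension s = to (∈-linearExtensions P (extension s))
      (Membershipₛ.∈-lookup (permutationSetoid n) (linearExtensions P) s)

    promoted∈ : ∀ i s →
      ∂ P (extension s) (extension s ⟨$⟩ˡ i) ∈ₚ linearExtensions P
    promoted∈ i s = from (∈-linearExtensions P (∂ P (extension s) (extension s ⟨$⟩ˡ i)))
      (∂-isLinearExtension P (extension s) _ (extension-isLinearExtension s))

  promote : Fin n → Fin N → Fin N
  promote i s = Any.index (promoted∈ i s)

  promote-≈ : ∀ i s → ∂ P (extension s) (extension s ⟨$⟩ˡ i) ≈ₚ extension (promote i s)
  promote-≈ i s = Any.lookup-index (promoted∈ i s)

  extension-injective : ∀ r s → extension r ≈ₚ extension s → r ≡ s
  extension-injective = lookup-injective (permutationSetoid n) (linearExtensions-unique P)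

  -- As the list has no repetitions, the promoted word occurs in it only at `promote i s`.
  G-represents : ∀ i → Represents (G P i) (promote i)
  G-represents i r s = cong (if_then 1 else 0) (does-⇔ (mk⇔
    (λ r≈ → extension-injective r (promote i s) λ k → trans (r≈ k) (promote-≈ i s k))
    (λ { refl k → sym (promote-≈ i s k) }))
    (extension r ≈ₚ? ∂ P (extension s) (extension s ⟨$⟩ˡ i)) (r Fin.≟ promote i s))

  private Word = Generated (matrixMonoid N) (G P)

  open Action (G P) promote G-represents public

  position : Fin N → Fin n → ℕ
  position s v = toℕ (extension s ⟨$⟩ˡ v)

  module _ (forest : IsRootedForest (PosetOn.poset P))
    (natural : PosetOn.IsNaturallyLabelled P) where

    open Forest P forest natural
    open PosetOn P

    promote-gap : ∀ i s {v t} → Moves i v t →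
      Gap (position s i) (position (promote i s) v) (place (extension s) t)
    promote-gap i s {v} mv = subst (λ x → Gap (position s i) (toℕ x) _)
      (inverse-cong (∂ P (extension s) (extension s ⟨$⟩ˡ i)) (extension (promote i s))
        (promote-≈ i s) v)
      (promotes P forest natural (extension s) (extension-isLinearExtension s) i mv)

    Precedes : Fin n × Fin n → Fin N → Set
    Precedes (u , v) s = position s u < position s v

    height : Fin n × Fin n → ℕ
    height (u , v) = toℕ u + toℕ v

    open Atoms Precedes height

    place≤n : ∀ π t → place π t ≤ n
    place≤n π (just w) = ℕ.<⇒≤ (Fin.toℕ<n _)
    place≤n π nothing  = ℕ.≤-refl

    moves-≤ : ∀ {i v w} → Moves i v (just w) → v Fin.≤ w
    moves-≤ (stays _)              = ℕ.≤-refl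
    moves-≤ (climbs _ (v≺w , _)) = ℕ.<⇒≤ (natural _ _ v≺w)

    -- Opening a gap preserves and reflects order, so promotion compares the old places taken by `a`
    -- and `b`. If `a` goes to the end it precedes nothing; if only `b` does, `a` precedes it.
    -- Otherwise each climb goes to a larger label.
    outcome-promote : ∀ i e → Outcome (promote i) e
    outcome-promote i (a , b) with moves-total i a | moves-total i b
    ... | ta , ma | tb , mb = go ma mb
      where
      moved : ∀ {ta tb} → Moves i a ta → Moves i b tb → ∀ s →
        Precedes (a , b) (promote i s) ⇔ place (extension s) ta < place (extension s) tb
      moved ma mb s = mk⇔ (gap-mono-< (promote-gap i s ma) (promote-gap i s mb))
        (gap-cancel-< (promote-gap i s ma) (promote-gap i s mb))
      go : ∀ {ta tb} → Moves i a ta → Moves i b tb → Outcome (promote i) (a , b)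
      go {nothing} {tb} ma mb = inj₂ (never λ s a<b →
        ℕ.<⇒≱ (to (moved ma mb s) a<b) (place≤n (extension s) tb))
      go {just _} {nothing} ma mb = inj₂ (always λ s → from (moved ma mb s) (Fin.toℕ<n _))
      go {just _} {just _} ma@(stays _) mb@(stays _) = inj₁ (moved ma mb)
      go {just _} {just _} ma@(stays _) mb@(climbs _ (b≺b′ , _)) =
        inj₂ (raised (ℕ.+-monoʳ-< (toℕ a) (natural _ _ b≺b′)) (moved ma mb))
      go {just _} {just _} ma@(climbs _ (a≺a′ , _)) mb =
        inj₂ (raised (ℕ.+-mono-<-≤ (natural _ _ a≺a′) (moves-≤ mb)) (moved ma mb))

    height≤ : ∀ e → height e ≤ n + n
    height≤ (u , v) = ℕ.+-mono-≤ (ℕ.<⇒≤ (Fin.toℕ<n u)) (ℕ.<⇒≤ (Fin.toℕ<n v))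

    outcome-act : ∀ {A} (p : Word A) e → Outcome (act p) e
    outcome-act (generator i) = outcome-promote i
    outcome-act unit          = outcome-id
    outcome-act (product p q) = outcome-∘ (outcome-act p) (outcome-act q)

    -- Passing to maps, `preimage-invariant` with `act p` as `h` shows that both images of `s` order
    -- every pair `u`, `v` alike.
    act-absorbs : ∀ {A B C} (p : Word A) (q : Word B) (r : Word C) → A ≋ A ⊗ B ⊗ C → A ≋ A ⊗ B
    act-absorbs p q r eq = represents-≋ (act-represents p) (act-represents (product p q)) λ s →
      sym (extension-injective _ _ (order-determines
        (extension (act p (act q s))) (extension (act p s)) λ u v →
        preimage-invariant height≤ (outcome-act q) (outcome-act r) (outcome-act p (u , v))
          (λ t → sym (represents-≗ (act-represents p)
            (act-represents (product (product p q) r)) eq t)) s))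

theorem6p9 : ∀ {ℓ : Level} (n : ℕ) (P : PosetOn n ℓ) →
    IsRootedForest (PosetOn.poset P) →
    PosetOn.IsNaturallyLabelled P →
    IsRTrivial (promotionMonoid P)
theorem6p9 n P forest natural = record
  { finite   = finite P
  ; rTrivial = λ (x , p) (y , q) (xM⊆yM , yM⊆xM) →
      -- Each ideal contains its own generator, so y = x b and x = y c. Then x = x b c, and
      -- absorption gives x = x b = y.
      let ((b , pb) , y≈xb) = yM⊆xM {y , q} ((ε , unit) , M.sym (M.identityʳ y))
          ((c , pc) , x≈yc) = xM⊆yM {x , p} ((ε , unit) , M.sym (M.identityʳ x))
      in M.trans (act-absorbs P forest natural p pb pc (M.trans x≈yc (M.∙-congʳ y≈xb))) (M.sym y≈xb)
  }
  where
  module M = Monoid (matrixMonoid (length (linearExtensions P)))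
  ε = M.ε
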